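{- In the simple game modeling the US legislative system, let $c_p(k)$, $c_v(k)$, $c_s(k)$, $c_r(k)$ denote the number of coalitions of size $k$ in which, respectively, the president, the vice president, a fixed senator, a fixed representative is critical. (a) If $c_p(k)=0$, then $c_v(k)=c_r(k)=c_s(k)=0$. (b) For all $k\in\mathbb{N}$ such that $c_p(k)\ne0$, $c_p(k)>c_v(k)$. (c) For all $k\in\mathbb{N}$ such that $c_p(k)\neq0$, $c_p(k)>c_s(k)$.
   Context: The simple game modeling the US legislative system has 537 players: the president, the vice president, 100 senators and 435 representatives. The "full Senate" is the 101-element set consisting of the 100 senators and the vice president. The minimal winning coalitions are of two types: (I) the president, 51 members of the full Senate, and 218 representatives; (II) 67 senators (the vice president does not count here) and 290 representatives. A coalition (set of players) is winning iff it contains a coalition of type I or II. A player $i$ in a coalition $T$ is critical in $T$ if $T$ is winning and $T\setminus\{i\}$ is not. -}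

module Defs where

open import Data.Fin using (Fin; zero; suc; _↑ˡ_; _↑ʳ_)
open import Data.Fin.Subset
  using (Subset; inside; outside; _∈_; _∉_; _⊆_; _∩_; _∪_; _-_; ∣_∣; ⁅_⁆; ⊤; ⊥)
open import Data.Fin.Subset.Properties using (anySubset?; _∈?_; _⊆?_)
open import Data.List using (List; []; _∷_; map; _++_; filter; length)
open import Data.Nat using (ℕ; zero; suc; _+_; _≟_)
open import Data.Product using (_×_; ∃-syntax)
open import Data.Sum using (_⊎_)
import Data.Vec as Vec
open import Level using (0ℓ)
open import Relation.Binary.PropositionalEquality using (_≡_)
open import Relation.Nullary using (¬_; ¬?; _×-dec_; _⊎-dec_)
open import Relation.Unary using (Pred; Decidable)

-- Every subset of Fin n occurs exactly once in this list.
allSubsets : ∀ n → List (Subset n)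
allSubsets zero    = Vec.[] ∷ []
allSubsets (suc n) =
  map (inside Vec.∷_) (allSubsets n) ++ map (outside Vec.∷_) (allSubsets n)

-- The simple game on Fin n in which a coalition wins iff it contains a
-- coalition satisfying Generating.
module SimpleGame {n : ℕ} (Generating : Pred (Subset n) 0ℓ)
                  (generating? : Decidable Generating) where

  Winning : Pred (Subset n) 0ℓ
  Winning T = ∃[ S ] (Generating S × S ⊆ T)

  winning? : Decidable Winning
  winning? T = anySubset? (λ S → generating? S ×-dec (S ⊆? T))

  Critical : Fin n → Pred (Subset n) 0ℓ
  Critical i T = i ∈ T × Winning T × ¬ Winning (T - i)

  critical? : ∀ i → Decidable (Critical i)
  critical? i T = (i ∈? T) ×-dec winning? T ×-dec ¬? (winning? (T - i))

  criticalCount : Fin n → ℕ → ℕ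
  criticalCount i k =
    length (filter (λ T → (∣ T ∣ ≟ k) ×-dec critical? i T) (allSubsets n))

-- Players are numbered in the order: president, vice president, senators,
-- representatives.
players : ℕ
players = 2 + (100 + 435)

Coalition : Set
Coalition = Subset players

president vicePresident : Fin players
president     = zero
vicePresident = suc zero

senator : Fin 100 → Fin players
senator i = 2 ↑ʳ (i ↑ˡ 435)

representative : Fin 435 → Fin players
representative j = 2 ↑ʳ (100 ↑ʳ j)

senate fullSenate house : Coalition
senate     = ⊥ {2} Vec.++ (⊤ {100} Vec.++ ⊥ {435})
fullSenate = ⁅ vicePresident ⁆ ∪ senate
house      = ⊥ {2} Vec.++ (⊥ {100} Vec.++ ⊤ {435})

TypeI : Pred Coalition 0ℓ
TypeI S = president ∈ S × ∣ S ∩ fullSenate ∣ ≡ 51 × ∣ S ∩ house ∣ ≡ 218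

TypeII : Pred Coalition 0ℓ
TypeII S = president ∉ S × vicePresident ∉ S
         × ∣ S ∩ senate ∣ ≡ 67 × ∣ S ∩ house ∣ ≡ 290

typeI? : Decidable TypeI
typeI? S = (president ∈? S) ×-dec (∣ S ∩ fullSenate ∣ ≟ 51)
         ×-dec (∣ S ∩ house ∣ ≟ 218)

typeII? : Decidable TypeII
typeII? S = ¬? (president ∈? S) ×-dec ¬? (vicePresident ∈? S)
          ×-dec (∣ S ∩ senate ∣ ≟ 67) ×-dec (∣ S ∩ house ∣ ≟ 290)

TypeIOrII : Pred Coalition 0ℓ
TypeIOrII S = TypeI S ⊎ TypeII S

typeIOrII? : Decidable TypeIOrII
typeIOrII? S = typeI? S ⊎-dec typeII? S

module USLegislature = SimpleGame TypeIOrII typeIOrII?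

cₚ cᵥ : ℕ → ℕ
cₚ = USLegislature.criticalCount president
cᵥ = USLegislature.criticalCount vicePresident

cₛ : Fin 100 → ℕ → ℕ
cₛ i = USLegislature.criticalCount (senator i)

cᵣ : Fin 435 → ℕ → ℕ
cᵣ j = USLegislature.criticalCount (representative j)

{-# OPTIONS --safe #-}

-- Let p be the president and x any other player.  If x is critical in T, then p is critical
-- in T when p ∈ T, and in (T ∖ {x}) ∪ {p} otherwise.  This map preserves sizes and is
-- injective, as x belongs to the image in the first case only; hence c_x ≤ c_p throughout.
--
-- For x a senator, an image W meets the full Senate in 51 members if x ∈ W, and contains
-- 66 senators if x ∉ W; for x the vice president, only the first case arises.  A coalition in
-- which p is critical and which has this form loses it, with p still critical, once x is
-- exchanged with a senator on the other side.  So the map misses a coalition of each size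
-- k with c_p(k) ≠ 0.
module Submission where

open import Defs
open import Data.Bool using (_∧_)
open import Data.Fin using (Fin; zero; suc; _↑ˡ_)
open import Data.Fin.Properties using (0≢1+n)
open import Data.Fin.Subset
  using (Subset; inside; outside; _∈_; _∉_; _⊆_; _∩_; _∪_; _-_; ∣_∣; ⁅_⁆; ⊥)
open import Data.Fin.Subset.Properties
open import Data.List using (List; []; _∷_; map; _++_; filter; length)
open import Data.List.Membership.Propositional using () renaming (_∈_ to _∈ₗ_)
open import Data.List.Membership.Propositional.Properties
  using (∈-++⁺ˡ; ∈-++⁺ʳ; ∈-++⁻; ∈-map⁺; ∈-map⁻; ∈-filter⁺; ∈-filter⁻; ∈-∃++)
open import Data.List.Properties using (length-map; length-++-sucʳ)
open import Data.List.Relation.Binary.Disjoint.Propositional using (Disjoint)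
open import Data.List.Relation.Unary.All as All using ([]; _∷_)
open import Data.List.Relation.Unary.AllPairs using ([]; _∷_)
import Data.List.Relation.Unary.All.Properties as Allₚ
open import Data.List.Relation.Unary.Any using (here; there)
open import Data.List.Relation.Unary.Unique.Propositional using (Unique)
import Data.List.Relation.Unary.Unique.Propositional.Properties as Uniqueₚ
open import Data.Nat using (ℕ; zero; suc; _≤_; _<_; _>_; z≤n; s≤s; s≤s⁻¹; _≟_)
open import Data.Nat.Properties
  using (≤-trans; ≤-reflexive; ≤-antisym; n≤1+n; m≤m+n; n≤0⇒n≡0; suc-injective; <⇒≢; ≮⇒≥; <⇒≱)
open import Data.Product using (_×_; _,_; ∃-syntax; proj₁; proj₂)
open import Data.Sum using (_⊎_; inj₁; inj₂)
import Data.Vec as Vec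
open Vec using ([]; _∷_; here; there)
open import Function using (_∘_)
open import Level using (0ℓ)
open import Relation.Binary.PropositionalEquality
  using (_≡_; _≢_; refl; sym; trans; cong; cong₂; subst)
open import Relation.Nullary using (¬_; Dec; yes; no; contradiction; _×-dec_)
open import Relation.Unary using (Pred; Decidable)

private variable
  m n : ℕ
  A B : Set

-- Comparing numbers of subsets by means of lists without repetition.

∈-allSubsets : (T : Subset n) → T ∈ₗ allSubsets n
∈-allSubsets []            = here refl
∈-allSubsets (inside ∷ T)  = ∈-++⁺ˡ (∈-map⁺ (inside ∷_) (∈-allSubsets T))
∈-allSubsets (outside ∷ T) =
  ∈-++⁺ʳ (map (inside ∷_) (allSubsets _)) (∈-map⁺ (outside ∷_) (∈-allSubsets T))

allSubsets-unique : ∀ n → Unique (allSubsets n)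
allSubsets-unique zero    = [] ∷ []
allSubsets-unique (suc n) =
  Uniqueₚ.++⁺ (Uniqueₚ.map⁺ (λ { refl → refl }) (allSubsets-unique n))
              (Uniqueₚ.map⁺ (λ { refl → refl }) (allSubsets-unique n))
              disjoint
  where
  disjoint : Disjoint (map (inside ∷_) (allSubsets n)) (map (outside ∷_) (allSubsets n))
  disjoint (T∈in , T∈out) with ∈-map⁻ _ T∈in | ∈-map⁻ _ T∈out
  ... | _ , _ , refl | _ , _ , ()

-- Pigeonhole by induction: one occurrence of the head of `xs` is cut out of `ys`. The tail still
-- lies in what is left, since uniqueness keeps the head from recurring there.
unique⇒length≤ : {xs ys : List A} → Unique xs → (∀ {x} → x ∈ₗ xs → x ∈ₗ ys) →
                 length xs ≤ length ys
unique⇒length≤ []            xs⊆ys = z≤n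
unique⇒length≤ {xs = x ∷ xs} (x≢xs ∷ xs!) xs⊆ys with ∈-∃++ (xs⊆ys (here refl))
... | as , bs , refl =
  ≤-trans (s≤s (unique⇒length≤ xs! xs⊆as++bs)) (≤-reflexive (sym (length-++-sucʳ as x bs)))
  where
  xs⊆as++bs : ∀ {y} → y ∈ₗ xs → y ∈ₗ as ++ bs
  xs⊆as++bs y∈xs with ∈-++⁻ as (xs⊆ys (there y∈xs))
  ... | inj₁ y∈as         = ∈-++⁺ˡ y∈as
  ... | inj₂ (here refl)  = contradiction refl (All.lookup x≢xs y∈xs)
  ... | inj₂ (there y∈bs) = ∈-++⁺ʳ as y∈bs

-- Injectivity is asked on members of `xs` only: the map used later is injective on coalitions
-- containing a given player, not on all subsets.
map-unique : {f : A → B} {xs : List A} →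
             (∀ {x y} → x ∈ₗ xs → y ∈ₗ xs → f x ≡ f y → x ≡ y) → Unique xs → Unique (map f xs)
map-unique f-inj []           = []
map-unique f-inj (x≢xs ∷ xs!) =
  Allₚ.map⁺ (All.tabulate λ y∈xs fx≡fy →
    All.lookup x≢xs y∈xs (f-inj (here refl) (there y∈xs) fx≡fy))
  ∷ map-unique (λ x∈xs y∈xs → f-inj (there x∈xs) (there y∈xs)) xs!

module _ {P Q : Pred (Subset n) 0ℓ} (P? : Decidable P) (Q? : Decidable Q)
         (f : Subset n → Subset n) (f-maps : ∀ {T} → P T → Q (f T))
         (f-inj : ∀ {T U} → P T → P U → f T ≡ f U → T ≡ U) where

  private
    image : List (Subset n)
    image = map f (filter P? (allSubsets n))

    image-unique : Unique image
    image-unique = map-unique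
      (λ T∈ U∈ → f-inj (proj₂ (∈-filter⁻ P? {xs = allSubsets n} T∈))
                       (proj₂ (∈-filter⁻ P? {xs = allSubsets n} U∈)))
      (Uniqueₚ.filter⁺ P? (allSubsets-unique n))

    ∈-image⁻ : ∀ {T} → T ∈ₗ image → ∃[ U ] (P U × T ≡ f U)
    ∈-image⁻ T∈ with ∈-map⁻ f T∈
    ... | U , U∈ , T≡fU = U , proj₂ (∈-filter⁻ P? {xs = allSubsets n} U∈) , T≡fU

    image⊆Q : ∀ {T} → T ∈ₗ image → T ∈ₗ filter Q? (allSubsets n)
    image⊆Q T∈ with ∈-image⁻ T∈
    ... | U , pU , refl = ∈-filter⁺ Q? (∈-allSubsets (f U)) (f-maps pU)

    length-image : length image ≡ length (filter P? (allSubsets n))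
    length-image = length-map f (filter P? (allSubsets n))

  injection⇒count≤ : length (filter P? (allSubsets n)) ≤ length (filter Q? (allSubsets n))
  injection⇒count≤ = subst (_≤ _) length-image (unique⇒length≤ image-unique image⊆Q)

  -- A missed `W` can be put in front of the image without creating a repetition, which gives one
  -- more element of `Q`.
  injection⇒count< : ∀ {W} → Q W → (∀ {T} → P T → f T ≢ W) →
    length (filter P? (allSubsets n)) < length (filter Q? (allSubsets n))
  injection⇒count< {W} qW W∉f = subst (λ l → suc l ≤ _) length-image
    (unique⇒length≤ {xs = W ∷ image} (All.tabulate W≢image ∷ image-unique) W∷image⊆Q)
    where
    W≢image : ∀ {T} → T ∈ₗ image → W ≢ T
    W≢image T∈ refl with ∈-image⁻ T∈
    ... | _ , pU , W≡fU = W∉f pU (sym W≡fU)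

    W∷image⊆Q : ∀ {T} → T ∈ₗ W ∷ image → T ∈ₗ filter Q? (allSubsets n)
    W∷image⊆Q (here refl) = ∈-filter⁺ Q? (∈-allSubsets W) qW
    W∷image⊆Q (there T∈)  = image⊆Q T∈

count≢0⇒∃ : {P : Pred (Subset n) 0ℓ} (P? : Decidable P) →
            length (filter P? (allSubsets n)) ≢ 0 → ∃[ T ] P T
count≢0⇒∃ {n} P? ≢0 with filter P? (allSubsets n) in eq
... | []    = contradiction refl ≢0
... | T ∷ _ = T , proj₂ (∈-filter⁻ P? {xs = allSubsets n} (subst (T ∈ₗ_) (sym eq) (here refl)))

-- Comparing critical counts in an arbitrary simple game.

module _ (Generating : Pred (Subset n) 0ℓ) (generating? : Decidable Generating) where
  open SimpleGame Generating generating?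

  criticalCount≢0⇒∃ : ∀ i k → criticalCount i k ≢ 0 → ∃[ T ] (∣ T ∣ ≡ k × Critical i T)
  criticalCount≢0⇒∃ i k = count≢0⇒∃ (λ T → (∣ T ∣ ≟ k) ×-dec critical? i T)

  module _ {i j : Fin n} (f : Subset n → Subset n)
           (f-size : ∀ {T} → Critical i T → ∣ f T ∣ ≡ ∣ T ∣)
           (f-critical : ∀ {T} → Critical i T → Critical j (f T))
           (f-inj : ∀ {T U} → Critical i T → Critical i U → f T ≡ f U → T ≡ U) where

    criticalCount-≤ : ∀ k → criticalCount i k ≤ criticalCount j k
    criticalCount-≤ k = injection⇒count≤
      (λ T → (∣ T ∣ ≟ k) ×-dec critical? i T) (λ T → (∣ T ∣ ≟ k) ×-dec critical? j T) f
      (λ (∣T∣≡k , crit) → trans (f-size crit) ∣T∣≡k , f-critical crit)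
      (λ (_ , crit) (_ , crit′) → f-inj crit crit′)

    criticalCount-< : ∀ {W} → Critical j W → (∀ {T} → Critical i T → f T ≢ W) →
                      criticalCount i ∣ W ∣ < criticalCount j ∣ W ∣
    criticalCount-< {W} critW W∉f = injection⇒count<
      (λ T → (∣ T ∣ ≟ ∣ W ∣) ×-dec critical? i T) (λ T → (∣ T ∣ ≟ ∣ W ∣) ×-dec critical? j T) f
      (λ (∣T∣≡k , crit) → trans (f-size crit) ∣T∣≡k , f-critical crit)
      (λ (_ , crit) (_ , crit′) → f-inj crit crit′)
      (refl , critW) (W∉f ∘ proj₂)

-- Removing one element, and its effect on the size of an intersection.

removal-size : ∀ {x} {T : Subset n} → x ∈ T → suc ∣ T - x ∣ ≡ ∣ T ∣
-- Removing `zero` leaves the tail in the form `T ─ ⊥`, so that a rewriting is needed to recover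
-- `T`.
removal-size {T = inside ∷ T}  here        = cong (suc ∘ ∣_∣) (p─⊥≡p T)
removal-size {T = inside ∷ _}  (there x∈T) = cong suc (removal-size x∈T)
removal-size {T = outside ∷ _} (there x∈T) = removal-size x∈T

removal-∉ : ∀ {x} {T : Subset n} → x ∉ T → T - x ≡ T
removal-∉ {x = zero}  {inside ∷ T}  x∉T = contradiction here x∉T
removal-∉ {x = zero}  {outside ∷ T} x∉T = cong (outside ∷_) (p─⊥≡p T)
removal-∉ {x = suc x} {t ∷ T}       x∉T = cong (t ∷_) (removal-∉ (x∉T ∘ there))

x∉T-x : ∀ x (T : Subset n) → x ∉ T - x
x∉T-x zero    (_ ∷ _) ()
x∉T-x (suc x) (_ ∷ T) (there x∈) = x∉T-x x T x∈

removal-injective : ∀ {x} {T U : Subset n} → x ∈ T → x ∈ U → T - x ≡ U - x → T ≡ U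
removal-injective {T = _ ∷ T} {U = _ ∷ U} here here eq =
  cong (inside ∷_) (trans (sym (p─⊥≡p T)) (trans (cong Vec.tail eq) (p─⊥≡p U)))
removal-injective (there x∈T) (there x∈U) eq =
  cong₂ _∷_ (cong Vec.head eq) (removal-injective x∈T x∈U (cong Vec.tail eq))

insertion-removal : ∀ {x} {T : Subset n} → x ∉ T → (T ∪ ⁅ x ⁆) - x ≡ T
insertion-removal {x = zero}  {inside ∷ T}  x∉T = contradiction here x∉T
insertion-removal {x = zero}  {outside ∷ T} x∉T = cong (outside ∷_) (trans (p─⊥≡p _) (∪-identityʳ T))
insertion-removal {x = suc x} {inside ∷ T}  x∉T = cong (inside ∷_) (insertion-removal (x∉T ∘ there))
insertion-removal {x = suc x} {outside ∷ T} x∉T = cong (outside ∷_) (insertion-removal (x∉T ∘ there))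

removal-∩ : ∀ x (T A : Subset n) → (T - x) ∩ A ≡ (T ∩ A) - x
removal-∩ zero    (t ∷ T) (a ∷ A) = cong (outside ∷_)
  (trans (cong (_∩ A) (p─⊥≡p T)) (sym (p─⊥≡p (T ∩ A))))
removal-∩ (suc x) (t ∷ T) (a ∷ A) = cong (t ∧ a ∷_) (removal-∩ x T A)

∣removal∩∣-∈ : ∀ {x} {T A : Subset n} → x ∈ T → x ∈ A → suc ∣ (T - x) ∩ A ∣ ≡ ∣ T ∩ A ∣
∣removal∩∣-∈ {T = T} {A} x∈T x∈A =
  trans (cong (suc ∘ ∣_∣) (removal-∩ _ T A)) (removal-size (x∈p∩q⁺ (x∈T , x∈A)))

∣removal∩∣-∉ : ∀ {x} (T : Subset n) {A} → x ∉ A → ∣ (T - x) ∩ A ∣ ≡ ∣ T ∩ A ∣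
∣removal∩∣-∉ T {A} x∉A =
  cong ∣_∣ (trans (removal-∩ _ T A) (removal-∉ (x∉A ∘ proj₂ ∘ x∈p∩q⁻ T A)))

∣∩∣≤1+∣removal∩∣ : ∀ x (T A : Subset n) → ∣ T ∩ A ∣ ≤ suc ∣ (T - x) ∩ A ∣
∣∩∣≤1+∣removal∩∣ x T A with x ∈? T ∩ A
... | yes x∈ = let x∈T , x∈A = x∈p∩q⁻ T A x∈ in ≤-reflexive (sym (∣removal∩∣-∈ x∈T x∈A))
... | no  x∉ = ≤-trans (≤-reflexive (cong ∣_∣ (sym (trans (removal-∩ x T A) (removal-∉ x∉)))))
                       (n≤1+n _)

∩-monoˡ-⊆ : ∀ {T U : Subset n} A → T ⊆ U → T ∩ A ⊆ U ∩ A
∩-monoˡ-⊆ {T = T} A T⊆U x∈ = let x∈T , x∈A = x∈p∩q⁻ T A x∈ in x∈p∩q⁺ (T⊆U x∈T , x∈A)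

∩-monoʳ-⊆ : ∀ (T : Subset n) {A B} → A ⊆ B → T ∩ A ⊆ T ∩ B
∩-monoʳ-⊆ T {A} A⊆B x∈ = let x∈T , x∈A = x∈p∩q⁻ T A x∈ in x∈p∩q⁺ (x∈T , A⊆B x∈A)

∣∩∣<⇒∃∉ : ∀ (T A : Subset n) → ∣ T ∩ A ∣ < ∣ A ∣ → ∃[ x ] (x ∈ A × x ∉ T)
∣∩∣<⇒∃∉ (inside ∷ T)  (inside ∷ A)  lt = let x , x∈A , x∉T = ∣∩∣<⇒∃∉ T A (s≤s⁻¹ lt)
                                        in suc x , there x∈A , x∉T ∘ drop-there
∣∩∣<⇒∃∉ (outside ∷ T) (inside ∷ A)  lt = zero , here , λ ()
∣∩∣<⇒∃∉ (inside ∷ T)  (outside ∷ A) lt = let x , x∈A , x∉T = ∣∩∣<⇒∃∉ T A lt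
                                        in suc x , there x∈A , x∉T ∘ drop-there
∣∩∣<⇒∃∉ (outside ∷ T) (outside ∷ A) lt = let x , x∈A , x∉T = ∣∩∣<⇒∃∉ T A lt
                                        in suc x , there x∈A , x∉T ∘ drop-there

0<∣∣⇒Nonempty : ∀ (T : Subset n) → 0 < ∣ T ∣ → ∃[ x ] x ∈ T
0<∣∣⇒Nonempty (inside ∷ T)  _  = zero , here
0<∣∣⇒Nonempty (outside ∷ T) lt = let x , x∈T = 0<∣∣⇒Nonempty T lt in suc x , there x∈T

-- Trimming to an exact count, and exchanging two elements.

record TrimmedOn (A T : Subset n) (m : ℕ) : Set where
  field
    trimmed  : Subset n
    trimmed⊆ : trimmed ⊆ T
    size     : ∣ trimmed ∩ A ∣ ≡ m
    retained : ∀ {x} → x ∈ T → x ∉ A → x ∈ trimmed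

  size-elsewhere : ∀ B → (∀ {x} → x ∈ A → x ∉ B) → ∣ trimmed ∩ B ∣ ≡ ∣ T ∩ B ∣
  size-elsewhere B disjoint = cong ∣_∣ (⊆-antisym (∩-monoˡ-⊆ B trimmed⊆) λ x∈ →
    let x∈T , x∈B = x∈p∩q⁻ T B x∈
    in x∈p∩q⁺ (retained x∈T (λ x∈A → disjoint x∈A x∈B) , x∈B))

open TrimmedOn

-- Turns a lower bound into the exact count demanded by `TypeI` and `TypeII`. The first `m` common
-- members of `A` and `T` are kept and the later ones dropped; nothing outside `A` is touched.
trim : ∀ (A T : Subset n) → m ≤ ∣ T ∩ A ∣ → TrimmedOn A T m
trim []            []            z≤n = record
  { trimmed = [] ; trimmed⊆ = λ () ; size = refl ; retained = λ () }
trim {m = zero} (inside ∷ A) (inside ∷ T) _ = let r = trim A T z≤n in record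
  { trimmed  = outside ∷ trimmed r
  ; trimmed⊆ = out⊆ (trimmed⊆ r)
  ; size     = size r
  ; retained = λ { here x∉A → contradiction here x∉A
                 ; (there x∈T) x∉A → there (retained r x∈T (x∉A ∘ there)) } }
trim {m = suc m} (inside ∷ A) (inside ∷ T) (s≤s m≤) = let r = trim A T m≤ in record
  { trimmed  = inside ∷ trimmed r
  ; trimmed⊆ = s⊆s (trimmed⊆ r)
  ; size     = cong suc (size r)
  ; retained = λ { here _ → here ; (there x∈T) x∉A → there (retained r x∈T (x∉A ∘ there)) } }
trim (inside ∷ A) (outside ∷ T) m≤ = let r = trim A T m≤ in record
  { trimmed  = outside ∷ trimmed r
  ; trimmed⊆ = s⊆s (trimmed⊆ r)
  ; size     = size r
  ; retained = λ { (there x∈T) x∉A → there (retained r x∈T (x∉A ∘ there)) } }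
trim (outside ∷ A) (inside ∷ T) m≤ = let r = trim A T m≤ in record
  { trimmed  = inside ∷ trimmed r
  ; trimmed⊆ = s⊆s (trimmed⊆ r)
  ; size     = size r
  ; retained = λ { here _ → here ; (there x∈T) x∉A → there (retained r x∈T (x∉A ∘ there)) } }
trim (outside ∷ A) (outside ∷ T) m≤ = let r = trim A T m≤ in record
  { trimmed  = outside ∷ trimmed r
  ; trimmed⊆ = s⊆s (trimmed⊆ r)
  ; size     = size r
  ; retained = λ { (there x∈T) x∉A → there (retained r x∈T (x∉A ∘ there)) } }

-- The equation between the two remainders is the useful part: any count for `U` is compared with
-- that for `T` by restoring one element on each side.
exchange : ∀ {x y} {T : Subset n} → x ∈ T → y ∉ T →
           ∃[ U ] (y ∈ U × x ∉ U × U - y ≡ T - x)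
exchange {x = x} {y} {T} x∈T y∉T =
  U , y∈U , x∉U , insertion-removal (y∉T ∘ p─q⊆p T ⁅ x ⁆)
  where
  U = (T - x) ∪ ⁅ y ⁆
  y∈U : y ∈ U
  y∈U = q⊆p∪q (T - x) ⁅ y ⁆ (x∈⁅x⁆ y)
  x∉U : x ∉ U
  x∉U x∈U with x∈p∪q⁻ (T - x) ⁅ y ⁆ x∈U
  ... | inj₁ x∈T-x = x∉T-x x T x∈T-x
  ... | inj₂ x∈⁅y⁆ = contradiction x∈T (subst (_∉ T) (sym (x∈⁅y⁆⇒x≡y y x∈⁅y⁆)) y∉T)

exchange-∈ : ∀ {x y} {T U : Subset n} {A} → x ∈ T → y ∈ U → U - y ≡ T - x → x ∈ A → y ∈ A →
             ∣ U ∩ A ∣ ≡ ∣ T ∩ A ∣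
exchange-∈ {A = A} x∈T y∈U eq x∈A y∈A =
  trans (sym (∣removal∩∣-∈ y∈U y∈A)) (trans (cong (λ V → suc ∣ V ∩ A ∣) eq) (∣removal∩∣-∈ x∈T x∈A))

exchange-∉ : ∀ {x y} (T U : Subset n) {A} → U - y ≡ T - x → x ∉ A → y ∉ A →
             ∣ U ∩ A ∣ ≡ ∣ T ∩ A ∣
exchange-∉ T U {A} eq x∉A y∉A =
  trans (sym (∣removal∩∣-∉ U y∉A)) (trans (cong (λ V → ∣ V ∩ A ∣) eq) (∣removal∩∣-∉ T x∉A))

exchange-size : ∀ {x y} {T U : Subset n} → x ∈ T → y ∈ U → U - y ≡ T - x → ∣ U ∣ ≡ ∣ T ∣
exchange-size x∈T y∈U eq =
  trans (sym (removal-size y∈U)) (trans (cong (suc ∘ ∣_∣) eq) (removal-size x∈T))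

-- The chambers and the officers outside them.

open USLegislature using (Winning; Critical; critical?)

fullSenate∩house : fullSenate ∩ house ≡ ⊥
fullSenate∩house = refl

fullSenate-house : ∀ {x} → x ∈ fullSenate → x ∉ house
fullSenate-house {x} x∈F x∈H = ∉⊥ (subst (x ∈_) fullSenate∩house (x∈p∩q⁺ (x∈F , x∈H)))

∣senate∣ : ∣ senate ∣ ≡ 100
∣senate∣ = refl

senate⊆fullSenate : senate ⊆ fullSenate
senate⊆fullSenate = q⊆p∪q ⁅ vicePresident ⁆ senate

senate-house : ∀ {x} → x ∈ senate → x ∉ house
senate-house = fullSenate-house ∘ senate⊆fullSenate

president∉fullSenate : president ∉ fullSenate
president∉fullSenate ()

president≢fullSenator : ∀ {x} → x ∈ fullSenate → president ≢ x
president≢fullSenator x∈F refl = president∉fullSenate x∈F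

president∉senate : president ∉ senate
president∉senate = president∉fullSenate ∘ senate⊆fullSenate

president∉house : president ∉ house
president∉house ()

vicePresident∈fullSenate : vicePresident ∈ fullSenate
vicePresident∈fullSenate = there here

vicePresident∉senate : vicePresident ∉ senate
vicePresident∉senate (there ())

vicePresident∉house : vicePresident ∉ house
vicePresident∉house = fullSenate-house vicePresident∈fullSenate

∈-++⁺ᵛ : ∀ {x} {T : Subset m} {U : Subset n} → x ∈ T → x ↑ˡ n ∈ T Vec.++ U
∈-++⁺ᵛ here        = here
∈-++⁺ᵛ (there x∈T) = there (∈-++⁺ᵛ x∈T)

senator∈senate : ∀ i → senator i ∈ senate
senator∈senate i = there (there (∈-++⁺ᵛ {x = i} ∈⊤))

∣∩senate∣≤∣∩fullSenate∣ : ∀ T → ∣ T ∩ senate ∣ ≤ ∣ T ∩ fullSenate ∣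
∣∩senate∣≤∣∩fullSenate∣ T = p⊆q⇒∣p∣≤∣q∣ (∩-monoʳ-⊆ T senate⊆fullSenate)

-- Winning coalitions described by quotas.

winning-I : ∀ {T} → president ∈ T → 51 ≤ ∣ T ∩ fullSenate ∣ → 218 ≤ ∣ T ∩ house ∣ → Winning T
winning-I {T} p∈T 51≤ 218≤ =
  trimmed t₂
  , inj₁ ( retained t₂ (retained t₁ p∈T president∉fullSenate) president∉house
         , trans (size-elsewhere t₂ fullSenate (λ x∈H x∈F → fullSenate-house x∈F x∈H))
                 (size t₁)
         , size t₂)
  , trimmed⊆ t₁ ∘ trimmed⊆ t₂
  where
  t₁ : TrimmedOn fullSenate T 51
  t₁ = trim fullSenate T 51≤

  -- The house is disjoint from the full Senate, so this second trimming preserves the count 51; the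
  -- president lies outside both sets and survives both trimmings.
  t₂ : TrimmedOn house (trimmed t₁) 218
  t₂ = trim house (trimmed t₁)
         (subst (218 ≤_) (sym (size-elsewhere t₁ house fullSenate-house)) 218≤)

-- Type II coalitions exclude the president and the vice president. These are removed first, at no
-- cost since neither is a senator or a representative; then both chambers are trimmed.
winning-II : ∀ {T} → 67 ≤ ∣ T ∩ senate ∣ → 290 ≤ ∣ T ∩ house ∣ → Winning T
winning-II {T} 67≤ 290≤ =
  trimmed t₂
  , inj₂ ( (λ p∈ → x∉T-x president T (p─q⊆p (T - president) ⁅ vicePresident ⁆ (t₂⊆T₀ p∈)))
         , (λ v∈ → x∉T-x vicePresident (T - president) (t₂⊆T₀ v∈))
         , trans (size-elsewhere t₂ senate (λ x∈H x∈S → senate-house x∈S x∈H))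
                 (size t₁)
         , size t₂)
  , p─q⊆p T ⁅ president ⁆ ∘ p─q⊆p (T - president) ⁅ vicePresident ⁆ ∘ t₂⊆T₀
  where
  T₀ : Coalition
  T₀ = T - president - vicePresident

  same : ∀ A → president ∉ A → vicePresident ∉ A → ∣ T₀ ∩ A ∣ ≡ ∣ T ∩ A ∣
  same A p∉A v∉A = trans (∣removal∩∣-∉ (T - president) v∉A) (∣removal∩∣-∉ T p∉A)

  t₁ : TrimmedOn senate T₀ 67
  t₁ = trim senate T₀
         (subst (67 ≤_) (sym (same senate president∉senate vicePresident∉senate)) 67≤)

  t₂ : TrimmedOn house (trimmed t₁) 290
  t₂ = trim house (trimmed t₁)
         (subst (290 ≤_)
           (sym (trans (size-elsewhere t₁ house senate-house)
                       (same house president∉house vicePresident∉house)))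
           290≤)

  t₂⊆T₀ : trimmed t₂ ⊆ T₀
  t₂⊆T₀ = trimmed⊆ t₁ ∘ trimmed⊆ t₂

-- Upward-closed forms of the two types: lower bounds replace exact counts, and type II no longer
-- excludes anyone. A coalition wins iff it meets one of them, by `winning-I`, `winning-II` and
-- `winning⇒quota`.
QuotaI QuotaII : Coalition → Set
QuotaI  T = president ∈ T × 51 ≤ ∣ T ∩ fullSenate ∣ × 218 ≤ ∣ T ∩ house ∣
QuotaII T = 67 ≤ ∣ T ∩ senate ∣ × 290 ≤ ∣ T ∩ house ∣

winning⇒quota : ∀ {T} → Winning T → QuotaI T ⊎ QuotaII T
winning⇒quota {T} (S , generates , S⊆T) = quotas generates
  where
  grow : ∀ A {m} → ∣ S ∩ A ∣ ≡ m → m ≤ ∣ T ∩ A ∣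
  grow A refl = p⊆q⇒∣p∣≤∣q∣ (∩-monoˡ-⊆ A S⊆T)

  quotas : TypeIOrII S → QuotaI T ⊎ QuotaII T
  quotas (inj₁ (p∈S , ∣S∩F∣≡51 , ∣S∩H∣≡218)) =
    inj₁ (S⊆T p∈S , grow fullSenate ∣S∩F∣≡51 , grow house ∣S∩H∣≡218)
  quotas (inj₂ (_ , _ , ∣S∩S∣≡67 , ∣S∩H∣≡290)) =
    inj₂ (grow senate ∣S∩S∣≡67 , grow house ∣S∩H∣≡290)

winning-∌⇒quotaII : ∀ {T} → president ∉ T → Winning T → QuotaII T
winning-∌⇒quotaII p∉T wT with winning⇒quota wT
... | inj₁ (p∈T , _) = contradiction p∈T p∉T
... | inj₂ quotaII   = quotaII

∣removal∩∣≤∣∩∣ : ∀ x (T A : Subset n) → ∣ (T - x) ∩ A ∣ ≤ ∣ T ∩ A ∣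
∣removal∩∣≤∣∩∣ x T A = p⊆q⇒∣p∣≤∣q∣ (∩-monoˡ-⊆ A (p─q⊆p T ⁅ x ⁆))

quotaII-removal⁻ : ∀ T x → QuotaII (T - x) → QuotaII T
quotaII-removal⁻ T x (67≤ , 290≤) =
  ≤-trans 67≤ (∣removal∩∣≤∣∩∣ x T senate) , ≤-trans 290≤ (∣removal∩∣≤∣∩∣ x T house)

quotaII⇒winning-removal : ∀ {x} T → x ∉ senate → x ∉ house → QuotaII T → Winning (T - x)
quotaII⇒winning-removal T x∉S x∉H (67≤ , 290≤) =
  winning-II (subst (67 ≤_) (sym (∣removal∩∣-∉ T x∉S)) 67≤)
             (subst (290 ≤_) (sym (∣removal∩∣-∉ T x∉H)) 290≤)

winning-removal-president⇒quotaII : ∀ {T} → Winning (T - president) → QuotaII T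
winning-removal-president⇒quotaII {T} =
  quotaII-removal⁻ T president ∘ winning-∌⇒quotaII (x∉T-x president T)

-- Losing one player costs at most one senator and one representative. The remaining 66 and 289
-- still exceed 51 and 218, so the president's presence suffices for type I.
quotaII⇒winning-with-president : ∀ {T U} i → QuotaII T → president ∈ U → T - i ⊆ U → Winning U
quotaII⇒winning-with-president {T} {U} i (67≤ , 290≤) p∈U T-i⊆U = winning-I p∈U
  (≤-trans (m≤m+n 51 15) (≤-trans (s≤s⁻¹ (≤-trans 67≤ (∣∩∣≤1+∣removal∩∣ i T senate)))
    (≤-trans (p⊆q⇒∣p∣≤∣q∣ (∩-monoˡ-⊆ senate T-i⊆U)) (∣∩senate∣≤∣∩fullSenate∣ U))))
  (≤-trans (m≤m+n 218 71) (≤-trans (s≤s⁻¹ (≤-trans 290≤ (∣∩∣≤1+∣removal∩∣ i T house)))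
    (p⊆q⇒∣p∣≤∣q∣ (∩-monoˡ-⊆ house T-i⊆U))))

-- The replacement map, with the president as player `zero`.

replaceByZero : Fin (suc n) → Subset (suc n) → Subset (suc n)
replaceByZero x (inside ∷ T)  = inside ∷ T
-- Inserting `zero` only changes the head, so the removal of `x` contributes its tail.
replaceByZero x (outside ∷ T) = inside ∷ Vec.tail ((outside ∷ T) - x)

zero∈replaceByZero : ∀ (x : Fin (suc n)) T → zero ∈ replaceByZero x T
zero∈replaceByZero x (inside ∷ T)  = here
zero∈replaceByZero x (outside ∷ T) = here

replaceByZero-∈ : ∀ (x : Fin (suc n)) {T} → zero ∈ T → replaceByZero x T ≡ T
replaceByZero-∈ x here = refl

replaceByZero-∉ : ∀ (x : Fin (suc n)) {T} → zero ∉ T → replaceByZero x T - zero ≡ T - x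
replaceByZero-∉ x       {inside ∷ T}  0∉T = contradiction here 0∉T
replaceByZero-∉ zero    {outside ∷ T} 0∉T =
  cong (outside ∷_) (p─⊥≡p (Vec.tail ((outside ∷ T) - zero)))
replaceByZero-∉ (suc i) {outside ∷ T} 0∉T = cong (outside ∷_) (p─⊥≡p (T - i))

replaceByZero-size : ∀ {x : Fin (suc n)} {T} → x ∈ T → ∣ replaceByZero x T ∣ ≡ ∣ T ∣
replaceByZero-size {T = inside ∷ T}  _           = refl
replaceByZero-size {T = outside ∷ T} (there x∈T) = removal-size x∈T

-- Whether `x` survives in the image tells which clause was applied, so the mixed cases are
-- contradictory. In the equal cases `T` is the image itself, or is recovered by putting `x` back.
replaceByZero-injective : ∀ {x : Fin (suc n)} {T U} → x ∈ T → x ∈ U →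
                          replaceByZero x T ≡ replaceByZero x U → T ≡ U
replaceByZero-injective {T = inside ∷ _}  {inside ∷ _}  _ _ eq = eq
replaceByZero-injective {x = suc i} {inside ∷ _} {outside ∷ U} (there i∈T) _ eq =
  contradiction (subst (i ∈_) (cong Vec.tail eq) i∈T) (x∉T-x i U)
replaceByZero-injective {x = suc i} {outside ∷ T} {inside ∷ _} _ (there i∈U) eq =
  contradiction (subst (i ∈_) (cong Vec.tail (sym eq)) i∈U) (x∉T-x i T)
replaceByZero-injective {T = outside ∷ _} {outside ∷ _} (there i∈T) (there i∈U) eq =
  cong (outside ∷_) (removal-injective i∈T i∈U (cong Vec.tail eq))

-- If the president is in `T` and `T - president` won, then `T` would meet `QuotaII`, and `T - x`,
-- which keeps the president, would win. If the president is not in `T`, then `T` meets `QuotaII`,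
-- so the image wins; taking the president out of it leaves the losing `T - x`.
replaceByZero-critical : ∀ {x T} → president ≢ x → Critical x T →
                         Critical president (replaceByZero x T)
replaceByZero-critical {x} {T} p≢x (x∈T , wT , ¬wT-x) = cases (president ∈? T)
  where
  cases : Dec (president ∈ T) → Critical president (replaceByZero x T)
  cases (yes p∈T) = subst (Critical president) (sym (replaceByZero-∈ x p∈T))
    (p∈T , wT , λ wT-p → ¬wT-x (quotaII⇒winning-with-president x
      (winning-removal-president⇒quotaII wT-p) (x∈p∧x≢y⇒x∈p-y p∈T p≢x) ⊆-refl))
  cases (no p∉T) =
    zero∈replaceByZero x T
    , quotaII⇒winning-with-president x (winning-∌⇒quotaII p∉T wT) (zero∈replaceByZero x T)
        (λ {y} y∈T-x → p─q⊆p (replaceByZero x T) ⁅ president ⁆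
                         (subst (y ∈_) (sym (replaceByZero-∉ x p∉T)) y∈T-x))
    , ¬wT-x ∘ subst Winning (replaceByZero-∉ x p∉T)

-- Weak and strict comparison with the president's count.

cₚ≢0⇒critical : ∀ k → cₚ k ≢ 0 → ∃[ T ] (∣ T ∣ ≡ k × Critical president T)
cₚ≢0⇒critical = criticalCount≢0⇒∃ TypeIOrII typeIOrII? president

module _ (x : Fin players) (p≢x : president ≢ x) where

  cₚ-max : ∀ k → USLegislature.criticalCount x k ≤ cₚ k
  cₚ-max = criticalCount-≤ TypeIOrII typeIOrII? (replaceByZero x)
    (replaceByZero-size ∘ proj₁) (replaceByZero-critical p≢x)
    (λ crit crit′ → replaceByZero-injective (proj₁ crit) (proj₁ crit′))

  module _ (Image : Pred Coalition 0ℓ)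
           (image : ∀ {T} → Critical x T → Image (replaceByZero x T)) where

    -- `Image` need only contain the values of the map: a coalition that fails it is certainly
    -- missed, which makes the inequality strict at its size.
    cₚ-strict-max-at : ∀ {k} → ∃[ W ] (∣ W ∣ ≡ k × Critical president W × ¬ Image W) →
                       USLegislature.criticalCount x k < cₚ k
    cₚ-strict-max-at (W , refl , critW , W∉) =
      criticalCount-< TypeIOrII typeIOrII? (replaceByZero x)
        (replaceByZero-size ∘ proj₁) (replaceByZero-critical p≢x)
        (λ crit crit′ → replaceByZero-injective (proj₁ crit) (proj₁ crit′))
        critW (λ crit eq → W∉ (subst Image eq (image crit)))

    cₚ-strict-max : (∀ {T} → Critical president T →
                      ∃[ W ] (∣ W ∣ ≡ ∣ T ∣ × Critical president W × ¬ Image W)) →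
                    ∀ k → cₚ k ≢ 0 → USLegislature.criticalCount x k < cₚ k
    cₚ-strict-max unhit k cₚ≢0 = strict (cₚ≢0⇒critical k cₚ≢0)
      where
      strict : ∀ {k} → ∃[ T ] (∣ T ∣ ≡ k × Critical president T) →
               USLegislature.criticalCount x k < cₚ k
      strict (T , refl , crit) = cₚ-strict-max-at (unhit crit)

-- Counts forced by criticality.

fullSenator-critical⇒ : ∀ {i T} → i ∈ fullSenate → Critical i T → president ∈ T →
                        ∣ T ∩ fullSenate ∣ ≡ 51
fullSenator-critical⇒ {i} {T} i∈F (i∈T , wT , ¬wT-i) p∈T = ≤-antisym
  -- With 52 members of the full Senate, `T - i` would keep 51 of them, the president and all its
  -- representatives, and so would win.
  (≮⇒≥ λ 52≤ → ¬wT-i (winning-I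
    (x∈p∧x≢y⇒x∈p-y p∈T (president≢fullSenator i∈F))
    (s≤s⁻¹ (subst (52 ≤_) (sym (∣removal∩∣-∈ i∈T i∈F)) 52≤))
    (subst (218 ≤_) (sym (∣removal∩∣-∉ T (fullSenate-house i∈F))) (proj₂ atLeast))))
  (proj₁ atLeast)
  where
  atLeast : 51 ≤ ∣ T ∩ fullSenate ∣ × 218 ≤ ∣ T ∩ house ∣
  atLeast with winning⇒quota wT
  ... | inj₁ (_ , quotas)   = quotas
  -- The type II numbers exceed those of type I, so the lower bounds hold in this case too.
  ... | inj₂ (67≤ , 290≤) =
    ≤-trans (m≤m+n 51 16) (≤-trans 67≤ (∣∩senate∣≤∣∩fullSenate∣ T))
    , ≤-trans (m≤m+n 218 72) 290≤

-- Without the president only type II is available, and a 68th senator would make `i` dispensable.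
senator-critical⇒ : ∀ {i T} → i ∈ senate → Critical i T → president ∉ T → ∣ T ∩ senate ∣ ≡ 67
senator-critical⇒ {i} {T} i∈S (i∈T , wT , ¬wT-i) p∉T =
  let 67≤ , 290≤ = winning-∌⇒quotaII p∉T wT in ≤-antisym
  (≮⇒≥ λ 68≤ → ¬wT-i (winning-II
    (s≤s⁻¹ (subst (68 ≤_) (sym (∣removal∩∣-∈ i∈T i∈S)) 68≤))
    (subst (290 ≤_) (sym (∣removal∩∣-∉ T (senate-house i∈S))) 290≤)))
  67≤

-- Without the president a win comes from type II, where the vice president does not count.
vicePresident-critical⇒ : ∀ {T} → Critical vicePresident T → president ∈ T
vicePresident-critical⇒ {T} (_ , wT , ¬wT-v) with president ∈? T
... | yes p∈T = p∈T
... | no  p∉T = contradiction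
  (quotaII⇒winning-removal T vicePresident∉senate vicePresident∉house (winning-∌⇒quotaII p∉T wT))
  ¬wT-v

president-critical⁺ : ∀ {T} → QuotaI T → ¬ QuotaII T → Critical president T
president-critical⁺ (p∈T , 51≤ , 218≤) ¬quotaII =
  p∈T , winning-I p∈T 51≤ 218≤ , ¬quotaII ∘ winning-removal-president⇒quotaII

president-critical⇒quotaI : ∀ {T} → Critical president T → QuotaI T
president-critical⇒quotaI {T} (p∈T , wT , ¬wT-p) with winning⇒quota wT
... | inj₁ quotaI  = quotaI
... | inj₂ quotaII =
  contradiction (quotaII⇒winning-removal T president∉senate president∉house quotaII) ¬wT-p

-- Exchanging within the full Senate preserves the type I quotas. The number of senators may change
-- when the vice president takes part, so the bound below 67 is what rules out type II for `U`.
exchange-critical : ∀ {T U x y} → x ∈ T → y ∈ U → U - y ≡ T - x →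
                    x ∈ fullSenate → y ∈ fullSenate → Critical president T →
                    ∣ U ∩ senate ∣ < 67 → Critical president U
exchange-critical {T} {U} {x} {y} x∈T y∈U eq x∈F y∈F crit U∩S<67 =
  let p∈T , 51≤ , 218≤ = president-critical⇒quotaI crit in president-critical⁺
  ( p─q⊆p U ⁅ y ⁆ (subst (president ∈_) (sym eq) (x∈p∧x≢y⇒x∈p-y p∈T (president≢fullSenator x∈F)))
  , subst (51 ≤_) (sym (exchange-∈ x∈T y∈U eq x∈F y∈F)) 51≤
  , subst (218 ≤_) (sym (exchange-∉ T U eq (fullSenate-house x∈F) (fullSenate-house y∈F))) 218≤)
  (λ (67≤ , _) → <⇒≱ U∩S<67 67≤)

-- Coalitions hit and missed by the replacement map.

∣∩senate∣≤51 : ∀ T → ∣ T ∩ fullSenate ∣ ≡ 51 → ∣ T ∩ senate ∣ ≤ 51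
∣∩senate∣≤51 T ≡51 = subst (∣ T ∩ senate ∣ ≤_) ≡51 (∣∩senate∣≤∣∩fullSenate∣ T)

∃senator∉ : ∀ {T} → ∣ T ∩ fullSenate ∣ ≡ 51 → ∃[ j ] (j ∈ senate × j ∉ T)
∃senator∉ {T} ≡51 = ∣∩∣<⇒∃∉ T senate
  (≤-trans (s≤s (∣∩senate∣≤51 T ≡51)) (subst (52 ≤_) (sym ∣senate∣) (m≤m+n 52 48)))

-- For a senator x, InImage x contains the values of replaceByZero x on the coalitions in which
-- x is critical.  OutsideImage is its complement, phrased positively.
InImage OutsideImage : Fin players → Coalition → Set
InImage      x W = x ∈ W × ∣ W ∩ fullSenate ∣ ≡ 51 ⊎ x ∉ W × ∣ W ∩ senate ∣ ≡ 66
OutsideImage x W = x ∈ W × ∣ W ∩ fullSenate ∣ ≢ 51 ⊎ x ∉ W × ∣ W ∩ senate ∣ ≢ 66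

outside⇒∉image : ∀ {x W} → OutsideImage x W → ¬ InImage x W
outside⇒∉image (inj₁ (_ , ≢51))   (inj₁ (_ , ≡51))   = ≢51 ≡51
outside⇒∉image (inj₁ (x∈W , _))   (inj₂ (x∉W , _))   = x∉W x∈W
outside⇒∉image (inj₂ (x∉W , _))   (inj₁ (x∈W , _))   = x∉W x∈W
outside⇒∉image (inj₂ (_ , ≢66))   (inj₂ (_ , ≡66))   = ≢66 ≡66

replaceByVicePresident-image : ∀ {U} → Critical vicePresident U →
  let W = replaceByZero vicePresident U in vicePresident ∈ W × ∣ W ∩ fullSenate ∣ ≡ 51
replaceByVicePresident-image {U} crit =
  subst (λ W → vicePresident ∈ W × ∣ W ∩ fullSenate ∣ ≡ 51)
    (sym (replaceByZero-∈ vicePresident p∈U))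
    (proj₁ crit , fullSenator-critical⇒ vicePresident∈fullSenate crit p∈U)
  where
  p∈U : president ∈ U
  p∈U = vicePresident-critical⇒ crit

-- If the president is in `U`, the map fixes `U`. Otherwise `U` has exactly 67 senators, and giving
-- up `x` for the president, who is not a senator, leaves 66.
replaceBySenator-image : ∀ {x U} → x ∈ senate → Critical x U → InImage x (replaceByZero x U)
replaceBySenator-image {x} {U} x∈S crit = cases (president ∈? U)
  where
  p≢x : president ≢ x
  p≢x = president≢fullSenator (senate⊆fullSenate x∈S)

  W : Coalition
  W = replaceByZero x U

  cases : Dec (president ∈ U) → InImage x W
  cases (yes p∈U) = inj₁ (subst (λ V → x ∈ V × ∣ V ∩ fullSenate ∣ ≡ 51)
    (sym (replaceByZero-∈ x p∈U))
    (proj₁ crit , fullSenator-critical⇒ (senate⊆fullSenate x∈S) crit p∈U))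
  cases (no p∉U) = inj₂
    ( (λ x∈W → x∉T-x x U (subst (x ∈_) (replaceByZero-∉ x p∉U)
                                  (x∈p∧x≢y⇒x∈p-y x∈W (p≢x ∘ sym))))
    , trans (sym (∣removal∩∣-∉ W president∉senate))
        (trans (cong (λ V → ∣ V ∩ senate ∣) (replaceByZero-∉ x p∉U))
          (suc-injective
            (trans (∣removal∩∣-∈ (proj₁ crit) x∈S) (senator-critical⇒ x∈S crit p∉U)))))

Witness : Fin players → Coalition → Set
Witness x T = ∃[ W ] (∣ W ∣ ≡ ∣ T ∣ × Critical president W × ¬ InImage x W)

-- Swapping `x` for an absent senator keeps 51 members of the full Senate, hence at most 51
-- senators: too few for type II, and too few for an image that lacks `x`.
exchange-out : ∀ {x T} → x ∈ fullSenate → x ∈ T → Critical president T →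
               ∣ T ∩ fullSenate ∣ ≡ 51 → Witness x T
exchange-out {x} {T} x∈F x∈T crit ≡51 =
  let j , j∈S , j∉T = ∃senator∉ {T} ≡51
      W , j∈W , x∉W , W-j≡T-x = exchange x∈T j∉T
      j∈F = senate⊆fullSenate j∈S
      ∣W∩S∣≤51 = ∣∩senate∣≤51 W (trans (exchange-∈ x∈T j∈W W-j≡T-x x∈F j∈F) ≡51)
  in W , exchange-size x∈T j∈W W-j≡T-x
   , exchange-critical x∈T j∈W W-j≡T-x x∈F j∈F crit (≤-trans (s≤s ∣W∩S∣≤51) (m≤m+n 52 15))
   , outside⇒∉image (inj₂ (x∉W , <⇒≢ (≤-trans (s≤s ∣W∩S∣≤51) (m≤m+n 52 14))))

-- Swapping a present senator for `x` keeps 66 senators: one short of type II, yet more than the 51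
-- full Senate members of an image that contains `x`.
exchange-in : ∀ {x T} → x ∈ senate → x ∉ T → Critical president T →
              ∣ T ∩ senate ∣ ≡ 66 → Witness x T
exchange-in {x} {T} x∈S x∉T crit ≡66 =
  let j , j∈T∩S = 0<∣∣⇒Nonempty (T ∩ senate) (subst (0 <_) (sym ≡66) (s≤s z≤n))
      j∈T , j∈S = x∈p∩q⁻ T senate j∈T∩S
      W , x∈W , j∉W , W-x≡T-j = exchange j∈T x∉T
      ∣W∩S∣≡66 = trans (exchange-∈ j∈T x∈W W-x≡T-j j∈S x∈S) ≡66
  in W , exchange-size j∈T x∈W W-x≡T-j
   , exchange-critical j∈T x∈W W-x≡T-j (senate⊆fullSenate j∈S) (senate⊆fullSenate x∈S) crit
       (≤-reflexive (cong suc ∣W∩S∣≡66))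
   , outside⇒∉image (inj₁ (x∈W , λ ≡51 →
       <⇒≱ (m≤m+n 52 14) (subst (_≤ 51) ∣W∩S∣≡66 (∣∩senate∣≤51 W ≡51))))

vicePresident-witness : ∀ {T} → Critical president T →
  ∃[ W ] (∣ W ∣ ≡ ∣ T ∣ × Critical president W × ¬ (vicePresident ∈ W × ∣ W ∩ fullSenate ∣ ≡ 51))
vicePresident-witness {T} crit = cases (vicePresident ∈? T) (∣ T ∩ fullSenate ∣ ≟ 51)
  where
  cases : Dec (vicePresident ∈ T) → Dec (∣ T ∩ fullSenate ∣ ≡ 51) →
    ∃[ W ] (∣ W ∣ ≡ ∣ T ∣ × Critical president W × ¬ (vicePresident ∈ W × ∣ W ∩ fullSenate ∣ ≡ 51))
  cases (no v∉T)  _         = T , refl , crit , v∉T ∘ proj₁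
  cases (yes _)   (no ≢51)  = T , refl , crit , ≢51 ∘ proj₂
  cases (yes v∈T) (yes ≡51) =
    -- The vice president's images all satisfy the first alternative of `InImage`, so a coalition
    -- outside both alternatives is missed.
    let W , ∣W∣ , critW , out = exchange-out vicePresident∈fullSenate v∈T crit ≡51
    in W , ∣W∣ , critW , out ∘ inj₁

-- `T` itself serves unless it has the form of an image; in that case the exchange in the matching
-- direction destroys the form.
senator-witness : ∀ {x T} → x ∈ senate → Critical president T → Witness x T
senator-witness {x} {T} x∈S crit = cases (x ∈? T) (∣ T ∩ fullSenate ∣ ≟ 51) (∣ T ∩ senate ∣ ≟ 66)
  where
  cases : Dec (x ∈ T) → Dec (∣ T ∩ fullSenate ∣ ≡ 51) → Dec (∣ T ∩ senate ∣ ≡ 66) → Witness x T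
  cases (yes x∈T) (yes ≡51) _         = exchange-out (senate⊆fullSenate x∈S) x∈T crit ≡51
  cases (yes x∈T) (no ≢51)  _         = T , refl , crit , outside⇒∉image (inj₁ (x∈T , ≢51))
  cases (no x∉T)  _         (yes ≡66) = exchange-in x∈S x∉T crit ≡66
  cases (no x∉T)  _         (no ≢66)  = T , refl , crit , outside⇒∉image (inj₂ (x∉T , ≢66))

-- The three claims.

cₚ>cᵥ : ∀ k → cₚ k ≢ 0 → cₚ k > cᵥ k
cₚ>cᵥ = cₚ-strict-max vicePresident 0≢1+n
  (λ W → vicePresident ∈ W × ∣ W ∩ fullSenate ∣ ≡ 51)
  replaceByVicePresident-image vicePresident-witness

cₚ>cₛ : ∀ i k → cₚ k ≢ 0 → cₚ k > cₛ i k
cₚ>cₛ i = cₚ-strict-max (senator i) 0≢1+n (InImage (senator i))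
  (replaceBySenator-image (senator∈senate i)) (senator-witness (senator∈senate i))

proposition5 : (∀ (k : ℕ) → cₚ k ≡ 0 → cᵥ k ≡ 0 × (∀ (j : Fin 435) → cᵣ j k ≡ 0) × (∀ (i : Fin 100) → cₛ i k ≡ 0))
    × (∀ (k : ℕ) → cₚ k ≢ 0 → cₚ k > cᵥ k)
    × (∀ (k : ℕ) → cₚ k ≢ 0 → ∀ (i : Fin 100) → cₚ k > cₛ i k)
proposition5 =
  (λ k cₚ≡0 →
    -- The weak inequality holds for every player other than the president, so a zero count for the
    -- president forces the others to zero.
    let vanishes : ∀ x → president ≢ x → USLegislature.criticalCount x k ≡ 0
        vanishes x p≢x = n≤0⇒n≡0 (subst (USLegislature.criticalCount x k ≤_) cₚ≡0 (cₚ-max x p≢x k))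
    in vanishes vicePresident 0≢1+n
     , (λ j → vanishes (representative j) 0≢1+n)
     , (λ i → vanishes (senator i) 0≢1+n))
  , cₚ>cᵥ
  , λ k cₚ≢0 i → cₚ>cₛ i k cₚ≢0
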